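{- For all $n\ge1$, $\mathsf{depth}^{\mathsf u}(\mathsf{MUX}_n)\ge\lceil\log_2(2\cdot3^n-1)\rceil$; that is, every hazard-free De Morgan formula computing $\mathsf{MUX}_n$ has depth at least $\lceil\log_2(2\cdot3^n-1)\rceil$.
   Context: $\mathsf{MUX}_n\colon\{0,1\}^{n+2^n}\to\{0,1\}$ is $\mathsf{MUX}_n(s_1,\dots,s_n,x_0,\dots,x_{2^n-1})=x_{\mathrm{bin}(s_1,\dots,s_n)}$, where $\mathrm{bin}(s_1,\dots,s_n)$ is the natural number with binary representation $s_1s_2\cdots s_n$. Three-valued logic: let $\mathsf u$ be a third symbol, thought of as $\tfrac12$, so $0<\mathsf u<1$; $x\wedge y=\min(x,y)$, $x\vee y=\max(x,y)$, $\neg x=1-x$ on $\{0,\mathsf u,1\}$. A resolution of $\alpha\in\{0,\mathsf u,1\}^m$ is a string $a\in\{0,1\}^m$ with $a_i=\alpha_i$ whenever $\alpha_i\ne\mathsf u$. The hazard-free extension $\tilde f$ of $f\colon\{0,1\}^m\to\{0,1\}$ is: $\tilde f(\alpha)=c\in\{0,1\}$ if $f(a)=c$ for all resolutions $a$ of $\alpha$, and $\tilde f(\alpha)=\mathsf u$ otherwise. A De Morgan formula is a binary tree whose internal nodes are labeled $\vee$ or $\wedge$ (fan-in two) and whose leaves are labeled by literals (a variable or its negation), evaluated on $\{0,\mathsf u,1\}$-inputs by the rules above. Depth is the length (number of edges) of the longest root-to-leaf path. A formula $F$ computing $f$ is hazard-free if $F(\alpha)=\tilde f(\alpha)$ for all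 $\alpha\in\{0,\mathsf u,1\}^m$. -}

module Defs where

open import Data.Bool.Base using (Bool; true; false)
import Data.Bool.Properties as Bool
open import Data.Digit using (Bit; 0b; 1b)
open import Data.Fin.Base using (Fin; zero; combine)
open import Data.Fin.Properties using (all?)
open import Data.Nat.Base using (ℕ; zero; suc; _+_; _∸_; _^_; _⊓_; _⊔_)
open import Data.Product.Base using (_,_; uncurry)
open import Data.Vec.Base using (Vec; []; _∷_; lookup; map; take; drop)
open import Level using (Level)
open import Relation.Binary.Definitions using (DecidableEquality)
open import Relation.Binary.PropositionalEquality.Core using (_≡_; _≢_; refl)
open import Relation.Nullary.Decidable.Core
  using (Dec; yes; no; map′; ¬?; _×-dec_; _→-dec_)
open import Relation.Unary using (Pred; Decidable)

-- The most significant bit comes first: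
-- toℕ (combine {m} {k} i j) ≡ k * toℕ i + toℕ j.

bit : Bool → Bit
bit false = 0b
bit true  = 1b

bin : ∀ {n} → Vec Bool n → Fin (2 ^ n)
bin []       = zero
bin (s ∷ ss) = combine (bit s) (bin ss)

MUX : ∀ n → Vec Bool (n + 2 ^ n) → Bool
MUX n v = lookup (drop n v) (bin (take n v))

data Three : Set where
  𝟎 𝐮 𝟏 : Three

infix  4 _≟_
infixr 7 _∧₃_
infixr 6 _∨₃_

_∧₃_ : Three → Three → Three
𝟎 ∧₃ y = 𝟎
𝟏 ∧₃ y = y
𝐮 ∧₃ 𝟎 = 𝟎
𝐮 ∧₃ 𝐮 = 𝐮
𝐮 ∧₃ 𝟏 = 𝐮

_∨₃_ : Three → Three → Three
𝟎 ∨₃ y = y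
𝟏 ∨₃ y = 𝟏
𝐮 ∨₃ 𝟎 = 𝐮
𝐮 ∨₃ 𝐮 = 𝐮
𝐮 ∨₃ 𝟏 = 𝟏

¬₃_ : Three → Three
¬₃ 𝟎 = 𝟏
¬₃ 𝐮 = 𝐮
¬₃ 𝟏 = 𝟎

-- With 𝐮 read as ½, `twice x` is 2x; the three lemmas after it say that the
-- connectives are min, max and 1 - x.

twice : Three → ℕ
twice 𝟎 = 0
twice 𝐮 = 1
twice 𝟏 = 2

∧₃-min : ∀ x y → twice (x ∧₃ y) ≡ twice x ⊓ twice y
∧₃-min 𝟎 y = refl
∧₃-min 𝐮 𝟎 = refl
∧₃-min 𝐮 𝐮 = refl
∧₃-min 𝐮 𝟏 = refl
∧₃-min 𝟏 𝟎 = refl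
∧₃-min 𝟏 𝐮 = refl
∧₃-min 𝟏 𝟏 = refl

∨₃-max : ∀ x y → twice (x ∨₃ y) ≡ twice x ⊔ twice y
∨₃-max 𝟎 y = refl
∨₃-max 𝐮 𝟎 = refl
∨₃-max 𝐮 𝐮 = refl
∨₃-max 𝐮 𝟏 = refl
∨₃-max 𝟏 𝟎 = refl
∨₃-max 𝟏 𝐮 = refl
∨₃-max 𝟏 𝟏 = refl

¬₃-1-x : ∀ x → twice (¬₃ x) ≡ 2 ∸ twice x
¬₃-1-x 𝟎 = refl
¬₃-1-x 𝐮 = refl
¬₃-1-x 𝟏 = refl

_≟_ : DecidableEquality Three
𝟎 ≟ 𝟎 = yes refl
𝟎 ≟ 𝐮 = no λ ()
𝟎 ≟ 𝟏 = no λ ()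
𝐮 ≟ 𝟎 = no λ ()
𝐮 ≟ 𝐮 = yes refl
𝐮 ≟ 𝟏 = no λ ()
𝟏 ≟ 𝟎 = no λ ()
𝟏 ≟ 𝐮 = no λ ()
𝟏 ≟ 𝟏 = yes refl

ι : Bool → Three
ι false = 𝟎
ι true  = 𝟏

Resolution : ∀ {m} → Vec Three m → Vec Bool m → Set
Resolution α a = ∀ i → lookup α i ≢ 𝐮 → ι (lookup a i) ≡ lookup α i

Stable : ∀ {m} → (Vec Bool m → Bool) → Vec Three m → Bool → Set
Stable f α c = ∀ a → Resolution α a → f a ≡ c

allVec? : ∀ {p : Level} {m} {P : Pred (Vec Bool m) p} →
          Decidable P → Dec (∀ a → P a)
allVec? {m = zero}  P? = map′ (λ { p [] → p }) (λ p → p []) (P? [])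
allVec? {m = suc m} P? =
  map′ (uncurry λ { f t (false ∷ a) → f a ; f t (true ∷ a) → t a })
       (λ p → (λ a → p (false ∷ a)) , (λ a → p (true ∷ a)))
       (allVec? (λ a → P? (false ∷ a)) ×-dec allVec? (λ a → P? (true ∷ a)))

resolution? : ∀ {m} (α : Vec Three m) → Decidable (Resolution α)
resolution? α a =
  all? λ i → ¬? (lookup α i ≟ 𝐮) →-dec (ι (lookup a i) ≟ lookup α i)

stable? : ∀ {m} (f : Vec Bool m → Bool) (α : Vec Three m) → Decidable (Stable f α)
stable? f α c = allVec? λ a → resolution? α a →-dec (f a Bool.≟ c)

-- Every α has a resolution, so at most one of the two tests succeeds and
-- their order is immaterial.

hazardFreeExtension : ∀ {m} → (Vec Bool m → Bool) → Vec Three m → Three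
hazardFreeExtension f α with stable? f α false | stable? f α true
... | yes _ | _     = 𝟎
... | no  _ | yes _ = 𝟏
... | no  _ | no  _ = 𝐮

data Literal (m : ℕ) : Set where
  pos neg : Fin m → Literal m

infixr 7 _∧_
infixr 6 _∨_

data Formula (m : ℕ) : Set where
  leaf    : Literal m → Formula m
  _∧_ _∨_ : Formula m → Formula m → Formula m

evalLiteral : ∀ {m} → Literal m → Vec Three m → Three
evalLiteral (pos i) α = lookup α i
evalLiteral (neg i) α = ¬₃ lookup α i

eval : ∀ {m} → Formula m → Vec Three m → Three
eval (leaf l) α = evalLiteral l α
eval (F ∧ G)  α = eval F α ∧₃ eval G α
eval (F ∨ G)  α = eval F α ∨₃ eval G α

depth : ∀ {m} → Formula m → ℕ
depth (leaf _) = 0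
depth (F ∧ G)  = suc (depth F ⊔ depth G)
depth (F ∨ G)  = suc (depth F ⊔ depth G)

Computes : ∀ {m} → Formula m → (Vec Bool m → Bool) → Set
Computes F f = ∀ a → eval F (map ι a) ≡ ι (f a)

HazardFree : ∀ {m} → Formula m → (Vec Bool m → Bool) → Set
HazardFree F f = ∀ α → eval F α ≡ hazardFreeExtension f α

{-# OPTIONS --safe #-}
-- For a ternary selector s and a bit c, the input `block c s` has selector s,
-- the value c on every data bit that s may select, and 𝐮 on the others; MUX is
-- stably c there.  Descending a hazard-free formula splits the 3ⁿ × 3ⁿ matrix of
-- pairs (block true s , block false t) into rectangles, one per leaf.  On a data
-- leaf all s, t have a common resolution, on a selector leaf none do.  Hence the
-- matrix C of compatibility is, over 𝔽₂, a sum of as many rank-one matrices as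
-- there are data leaves, and J − C (J all ones) one of as many as there are
-- selector leaves.  C is the n-th tensor power of an invertible 3 × 3 matrix, so
-- there are at least 3ⁿ data leaves and 3ⁿ − 1 selector leaves.
module Submission where

open import Defs
import Data.Nat.Properties as ℕ
open import Algebra.Properties.CommutativeSemigroup ℕ.+-commutativeSemigroup using (interchange)
open import Data.Bool.Base using (Bool; true; false; not; if_then_else_; _xor_)
  renaming (_∧_ to _∧ᵇ_)
open import Data.Bool.Properties using (∧-conicalˡ; ∧-conicalʳ; ∧-assoc; ∧-zeroʳ)
open import Data.Bool.Solver using (module xor-∧-Solver)
open import Data.Digit using (Bit)
open import Data.Fin.Base using (Fin; zero; suc; combine; remQuot; splitAt; _↑ˡ_; _↑ʳ_)
open import Data.Fin.Properties using (remQuot-combine; combine-remQuot; injective⇒≤)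
open import Data.Nat.Base using (ℕ; zero; suc; _+_; _*_; _∸_; _^_; _⊔_; _≤_)
open import Data.Nat.Logarithm using (⌈log₂_⌉; ⌈log₂⌉-mono-≤; ⌈log₂2^n⌉≡n)
open import Data.Product.Base using (Σ-syntax; _×_; _,_; proj₁; proj₂)
open import Data.Sum.Base using (inj₁; inj₂; [_,_]′)
open import Data.Vec.Base using (Vec; []; _∷_; _++_; lookup; map; take; drop; tabulate)
open import Data.Vec.Properties
  using (++-injective; ∷-injectiveˡ; lookup-++ˡ; lookup-++ʳ; lookup-splitAt;
         lookup∘tabulate; tabulate∘lookup; tabulate-cong; take++drop≡id)
open import Function.Base using (_∘_; const)
open import Relation.Binary.PropositionalEquality
open import Relation.Nullary.Decidable.Core using (yes; no)
open import Relation.Nullary.Negation.Core using (contradiction)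

private
  variable
    m n r r′ : ℕ
    R : Set

-- Positional encodings

unbit : Bit → Bool
unbit zero       = false
unbit (suc zero) = true

unbit-bit : ∀ b → unbit (bit b) ≡ b
unbit-bit false = refl
unbit-bit true  = refl

bit-unbit : ∀ d → bit (unbit d) ≡ d
bit-unbit zero       = refl
bit-unbit (suc zero) = refl

unbin : ∀ n → Fin (2 ^ n) → Vec Bool n
unbin zero    _ = []
unbin (suc n) i = let q , r = remQuot {2} (2 ^ n) i in unbit q ∷ unbin n r

unbin-bin : (a : Vec Bool n) → unbin n (bin a) ≡ a
unbin-bin []      = refl
unbin-bin (b ∷ a) = trans
  (cong (λ (q , r) → unbit q ∷ unbin _ r) (remQuot-combine (bit b) (bin a)))
  (cong₂ _∷_ (unbit-bit b) (unbin-bin a))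

bin-unbin : ∀ n (i : Fin (2 ^ n)) → bin (unbin n i) ≡ i
bin-unbin zero    zero = refl
bin-unbin (suc n) i =
  let q , r = remQuot {2} (2 ^ n) i
  in trans (cong₂ combine (bit-unbit q) (bin-unbin n r)) (combine-remQuot {2} (2 ^ n) i)

trit : Three → Fin 3
trit 𝟎 = zero
trit 𝐮 = suc zero
trit 𝟏 = suc (suc zero)

untrit : Fin 3 → Three
untrit zero             = 𝟎
untrit (suc zero)       = 𝐮
untrit (suc (suc zero)) = 𝟏

trit-untrit : ∀ d → trit (untrit d) ≡ d
trit-untrit zero             = refl
trit-untrit (suc zero)       = refl
trit-untrit (suc (suc zero)) = refl

tern : Vec Three n → Fin (3 ^ n)
tern []      = zero
tern (x ∷ s) = combine (trit x) (tern s)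

untern : ∀ n → Fin (3 ^ n) → Vec Three n
untern zero    _ = []
untern (suc n) i = let q , r = remQuot {3} (3 ^ n) i in untrit q ∷ untern n r

tern-untern : ∀ n (i : Fin (3 ^ n)) → tern (untern n i) ≡ i
tern-untern zero    zero = refl
tern-untern (suc n) i =
  let q , r = remQuot {3} (3 ^ n) i
  in trans (cong₂ combine (trit-untrit q) (tern-untern n r)) (combine-remQuot {3} (3 ^ n) i)

-- Pigeonhole on the `2 ^ m` and `2 ^ n` bit vectors; it stands in for comparing dimensions in the
-- rank bound.
vec-injective⇒≤ : (f : Vec Bool m → Vec Bool n) → (∀ v v′ → f v ≡ f v′ → v ≡ v′) → m ≤ n
vec-injective⇒≤ {m} {n} f inj = ℕ.≮⇒≥ λ n<m → ℕ.<⇒≱ (ℕ.^-monoʳ-< 2 ℕ.≤-refl n<m)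
  (injective⇒≤ {f = bin ∘ f ∘ unbin m} λ {i} {j} eq →
    bin-unbin-injective i j (inj _ _ (bin-injective _ _ eq)))
  where
  bin-injective : (a a′ : Vec Bool n) → bin a ≡ bin a′ → a ≡ a′
  bin-injective a a′ eq = trans (sym (unbin-bin a)) (trans (cong (unbin n) eq) (unbin-bin a′))

  bin-unbin-injective : (i j : Fin (2 ^ m)) → unbin m i ≡ unbin m j → i ≡ j
  bin-unbin-injective i j eq = trans (sym (bin-unbin m i)) (trans (cong bin eq) (bin-unbin m j))

-- Linear algebra over 𝔽₂

⨁ : (Vec Three n → Bool) → Bool
⨁ {zero}  f = f []
⨁ {suc n} f = ⨁ (f ∘ (𝟎 ∷_)) xor (⨁ (f ∘ (𝟏 ∷_)) xor ⨁ (f ∘ (𝐮 ∷_)))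

⨁-cong : {f g : Vec Three n → Bool} → f ≗ g → ⨁ f ≡ ⨁ g
⨁-cong {zero}  eq = eq []
⨁-cong {suc n} eq =
  cong₂ _xor_ (⨁-cong (eq ∘ (𝟎 ∷_))) (cong₂ _xor_ (⨁-cong (eq ∘ (𝟏 ∷_))) (⨁-cong (eq ∘ (𝐮 ∷_))))

⨁-false : ∀ n → ⨁ {n} (const false) ≡ false
⨁-false zero = refl
⨁-false (suc n) rewrite ⨁-false n = refl

⨁-xor : (f g : Vec Three n → Bool) → ⨁ (λ t → f t xor g t) ≡ ⨁ f xor ⨁ g
⨁-xor {zero}  f g = refl
⨁-xor {suc n} f g
  rewrite ⨁-xor (f ∘ (𝟎 ∷_)) (g ∘ (𝟎 ∷_))
        | ⨁-xor (f ∘ (𝟏 ∷_)) (g ∘ (𝟏 ∷_))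
        | ⨁-xor (f ∘ (𝐮 ∷_)) (g ∘ (𝐮 ∷_)) =
  solve 6 (λ a a′ b b′ c c′ →
      (a :+ a′) :+ ((b :+ b′) :+ (c :+ c′)) := (a :+ (b :+ c)) :+ (a′ :+ (b′ :+ c′)))
    refl (⨁ (f ∘ (𝟎 ∷_))) (⨁ (g ∘ (𝟎 ∷_))) (⨁ (f ∘ (𝟏 ∷_))) (⨁ (g ∘ (𝟏 ∷_)))
    (⨁ (f ∘ (𝐮 ∷_))) (⨁ (g ∘ (𝐮 ∷_)))
  where open xor-∧-Solver

⨁-∧ : ∀ a (f : Vec Three n → Bool) → ⨁ (λ t → a ∧ᵇ f t) ≡ a ∧ᵇ ⨁ f
⨁-∧ {n} false f = ⨁-false n
⨁-∧     true  f = refl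

Matrix : Set → ℕ → Set
Matrix R n = R → Vec Three n → Bool

infixl 7 _·_

_·_ : Matrix R n → (Vec Three n → Bool) → R → Bool
(M · w) s = ⨁ λ t → M s t ∧ᵇ w t

-- Stands in for "M has rank at most r": applying a sum of r rank-one matrices to
-- w uses only r bits of information about w.
RankAtMost : ℕ → Matrix R n → Set
RankAtMost {n = n} r M =
  Σ[ g ∈ ((Vec Three n → Bool) → Vec Bool r) ] (∀ w w′ → g w ≡ g w′ → M · w ≗ M · w′)

rank-resp : {M N : Matrix R n} → (∀ s t → M s t ≡ N s t) → RankAtMost r N → RankAtMost r M
rank-resp eq (g , det) = g , λ w w′ gw≡gw′ s →
  trans (⨁-cong λ t → cong (_∧ᵇ w t) (eq s t))
    (trans (det w w′ gw≡gw′ s) (⨁-cong λ t → cong (_∧ᵇ w′ t) (sym (eq s t))))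

rank-zero : RankAtMost {R = R} {n} 0 (λ _ _ → false)
rank-zero = (λ _ → []) , λ _ _ _ _ → refl

-- The image of `w` is `X` scaled by the inner product of `Y` with `w`, so that single bit suffices.
rank-one : (X : R → Bool) (Y : Vec Three n → Bool) → RankAtMost 1 (λ s t → X s ∧ᵇ Y t)
rank-one X Y = (λ w → dot w ∷ []) , λ w w′ eq s →
  trans (factor w s) (trans (cong (X s ∧ᵇ_) (∷-injectiveˡ eq)) (sym (factor w′ s)))
  where
  dot : (_ → Bool) → Bool
  dot w = ⨁ λ t → Y t ∧ᵇ w t

  factor : ∀ w s → ⨁ (λ t → (X s ∧ᵇ Y t) ∧ᵇ w t) ≡ X s ∧ᵇ dot w
  factor w s = trans (⨁-cong λ t → ∧-assoc (X s) (Y t) (w t)) (⨁-∧ (X s) λ t → Y t ∧ᵇ w t)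

rank-+ : {M N : Matrix R n} → RankAtMost r M → RankAtMost r′ N →
         RankAtMost (r + r′) (λ s t → M s t xor N s t)
rank-+ {M = M} {N} (g , detM) (h , detN) = (λ w → g w ++ h w) , λ w w′ eq s →
  let gw≡gw′ , hw≡hw′ = ++-injective (g w) (g w′) eq
  in trans (·-xor w s)
       (trans (cong₂ _xor_ (detM w w′ gw≡gw′ s) (detN w w′ hw≡hw′ s)) (sym (·-xor w′ s)))
  where
  open xor-∧-Solver
  ·-xor : ∀ w s → ((λ s t → M s t xor N s t) · w) s ≡ (M · w) s xor (N · w) s
  ·-xor w s = trans
    (⨁-cong λ t → solve 3 (λ a b c → (a :+ b) :* c := a :* c :+ b :* c) refl (M s t) (N s t) (w t))
    (⨁-xor (λ t → M s t ∧ᵇ w t) (λ t → N s t ∧ᵇ w t))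

-- The `r` bits determine `M · w`, and injectivity of `M` recovers `w` from it. So the bit vectors
-- of length `3 ^ n`, read as functions along `tern`, get distinct codes.
rank-lower-bound : {M : Matrix R n} → (∀ w w′ → M · w ≗ M · w′ → w ≗ w′) →
                   RankAtMost r M → 3 ^ n ≤ r
rank-lower-bound {n = n} inj (g , det) = vec-injective⇒≤ (λ v → g (lookup v ∘ tern)) λ v v′ eq →
  trans (sym (tabulate∘lookup v))
    (trans (tabulate-cong λ i → subst (λ j → lookup v j ≡ lookup v′ j) (tern-untern n i)
              (inj _ _ (det _ _ eq) (untern n i)))
           (tabulate∘lookup v′))

-- The compatibility matrix

agree : Three → Three → Bool
agree 𝟎 𝟏 = false
agree 𝟏 𝟎 = false
agree _ _ = true

-- Existence of a common resolution, tested letter by letter. Against `map ι a` it says that `a` is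
-- a resolution of `s`.
compatible : Vec Three n → Vec Three n → Bool
compatible []      []      = true
compatible (x ∷ s) (y ∷ t) = agree x y ∧ᵇ compatible s t

-- Here `a` resolves both strings; opposite definite letters of `s` and `t` would need opposite bits
-- of `a`.
compatible-via : (s t : Vec Three n) (a : Vec Bool n) →
                 compatible s (map ι a) ≡ true → compatible t (map ι a) ≡ true →
                 compatible s t ≡ true
compatible-via []      []      []      _ _ = refl
compatible-via (x ∷ s) (y ∷ t) (b ∷ a) p q = cong₂ _∧ᵇ_
  (agree-via x y b (∧-conicalˡ _ _ p) (∧-conicalˡ _ _ q))
  (compatible-via s t a (∧-conicalʳ (agree x (ι b)) _ p) (∧-conicalʳ (agree y (ι b)) _ q))
  where
  agree-via : ∀ x y b → agree x (ι b) ≡ true → agree y (ι b) ≡ true → agree x y ≡ true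
  agree-via 𝟎 𝟎 _     _  _  = refl
  agree-via 𝟎 𝐮 _     _  _  = refl
  agree-via 𝟎 𝟏 false _  ()
  agree-via 𝟎 𝟏 true  () _
  agree-via 𝐮 _ _     _  _  = refl
  agree-via 𝟏 𝟎 false () _
  agree-via 𝟏 𝟎 true  _  ()
  agree-via 𝟏 𝐮 _     _  _  = refl
  agree-via 𝟏 𝟏 _     _  _  = refl

conflict⇒incompatible : (s t : Vec Three n) (i : Fin n) →
                        agree (lookup s i) (lookup t i) ≡ false → compatible s t ≡ false
conflict⇒incompatible (x ∷ s) (y ∷ t) zero    eq = cong (_∧ᵇ compatible s t) eq
conflict⇒incompatible (x ∷ s) (y ∷ t) (suc i) eq =
  trans (cong (agree x y ∧ᵇ_) (conflict⇒incompatible s t i eq)) (∧-zeroʳ (agree x y))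

resolution⇒compatible : (s : Vec Three n) (a : Vec Bool n) →
                        Resolution s a → compatible s (map ι a) ≡ true
resolution⇒compatible []      []      _   = refl
resolution⇒compatible (x ∷ s) (b ∷ a) res =
  cong₂ _∧ᵇ_ (agree-ι x b (res zero)) (resolution⇒compatible s a (res ∘ suc))
  where
  agree-ι : ∀ x b → (x ≢ 𝐮 → ι b ≡ x) → agree x (ι b) ≡ true
  agree-ι 𝟎 b h rewrite h (λ ()) = refl
  agree-ι 𝐮 b h = refl
  agree-ι 𝟏 b h rewrite h (λ ()) = refl

-- The induction step inverts the 3 × 3 matrix `agree` over 𝔽₂.
compatible-injective : (w w′ : Vec Three n → Bool) →
                       compatible · w ≗ compatible · w′ → w ≗ w′
compatible-injective {zero}  w w′ eq [] = eq []
compatible-injective {suc n} w w′ eq = λ where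
    (𝟎 ∷ t) → compatible-injective _ _ eq𝟎 t
    (𝐮 ∷ t) → compatible-injective _ _ eq𝐮 t
    (𝟏 ∷ t) → compatible-injective _ _ eq𝟏 t
  where
  open xor-∧-Solver

  C : (Vec Three (suc n) → Bool) → Three → Vec Three n → Bool
  C w x = compatible · (w ∘ (x ∷_))

  -- Row 𝟎 of `agree` vanishes at 𝟏, so the middle sum is constantly false and drops out.
  row𝟎 : ∀ s → C w 𝟎 s xor C w 𝐮 s ≡ C w′ 𝟎 s xor C w′ 𝐮 s
  row𝟎 s = subst (λ z → C w 𝟎 s xor (z xor C w 𝐮 s) ≡ C w′ 𝟎 s xor (z xor C w′ 𝐮 s))
    (⨁-false n) (eq (𝟎 ∷ s))

  row𝟏 : ∀ s → C w 𝟏 s xor C w 𝐮 s ≡ C w′ 𝟏 s xor C w′ 𝐮 s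
  row𝟏 s = subst (λ z → z xor (C w 𝟏 s xor C w 𝐮 s) ≡ z xor (C w′ 𝟏 s xor C w′ 𝐮 s))
    (⨁-false n) (eq (𝟏 ∷ s))

  cancelˡ : ∀ a b → a xor (a xor b) ≡ b
  cancelˡ = solve 2 (λ a b → a :+ (a :+ b) := b) refl

  cancelʳ : ∀ a b → (a xor b) xor b ≡ a
  cancelʳ = solve 2 (λ a b → (a :+ b) :+ b := a) refl

  -- Row 𝐮 of `agree` is all ones and row 𝟏 misses only 𝟎, so their sum isolates the 𝟎 component.
  eq𝟎 : C w 𝟎 ≗ C w′ 𝟎
  eq𝟎 s = trans (sym (cancelʳ (C w 𝟎 s) _))
    (trans (cong₂ _xor_ (eq (𝐮 ∷ s)) (row𝟏 s)) (cancelʳ (C w′ 𝟎 s) _))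

  eq𝐮 : C w 𝐮 ≗ C w′ 𝐮
  eq𝐮 s = trans (sym (cancelˡ (C w 𝟎 s) _))
    (trans (cong₂ _xor_ (eq𝟎 s) (row𝟎 s)) (cancelˡ (C w′ 𝟎 s) _))

  eq𝟏 : C w 𝟏 ≗ C w′ 𝟏
  eq𝟏 s = trans (sym (cancelʳ (C w 𝟏 s) _))
    (trans (cong₂ _xor_ (row𝟏 s) (eq𝐮 s)) (cancelʳ (C w′ 𝟏 s) _))

-- Stable inputs of the multiplexer

cell : Bool → Vec Three n → Fin (2 ^ n) → Three
cell c s b = if compatible s (map ι (unbin _ b)) then ι c else 𝐮

block : Bool → Vec Three n → Vec Three (n + 2 ^ n)
block c s = s ++ tabulate (cell c s)

ι-injective : ∀ {b c} → ι b ≡ ι c → b ≡ c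
ι-injective {false} {false} _ = refl
ι-injective {true}  {true}  _ = refl

ι≢𝐮 : ∀ c → ι c ≢ 𝐮
ι≢𝐮 false ()
ι≢𝐮 true  ()

resolution-++ : (α : Vec Three m) (β : Vec Three n) (a : Vec Bool m) (b : Vec Bool n) →
                Resolution (α ++ β) (a ++ b) → Resolution α a × Resolution β b
resolution-++ {m} {n} α β a b res =
    (λ i → subst₂ (λ x y → x ≢ 𝐮 → ι y ≡ x) (lookup-++ˡ α β i) (lookup-++ˡ a b i) (res (i ↑ˡ n)))
  , (λ i → subst₂ (λ x y → x ≢ 𝐮 → ι y ≡ x) (lookup-++ʳ α β i) (lookup-++ʳ a b i) (res (m ↑ʳ i)))

-- A resolution of the block selects an address that resolves `s`. The cell there is `ι c`, not 𝐮,
-- so the selected data bit must be `c`.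
block-stable : ∀ c (s : Vec Three n) → Stable (MUX n) (block c s) c
block-stable {n} c s a res = ι-injective (trans (data-res (λ eq → ι≢𝐮 c (trans (sym selected) eq))) selected)
  where
  i : Fin (2 ^ n)
  i = bin (take n a)

  split-res : Resolution s (take n a) × Resolution (tabulate (cell c s)) (drop n a)
  split-res = resolution-++ s _ (take n a) (drop n a)
    (subst (Resolution (block c s)) (sym (take++drop≡id n a)) res)

  data-res : lookup (tabulate (cell c s)) i ≢ 𝐮 → ι (lookup (drop n a) i) ≡ lookup (tabulate (cell c s)) i
  data-res = proj₂ split-res i

  selected : lookup (tabulate (cell c s)) i ≡ ι c
  selected = trans (lookup∘tabulate (cell c s) i)
    (cong (if_then ι c else 𝐮)
      (trans (cong (compatible s ∘ map ι) (unbin-bin (take n a)))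
             (resolution⇒compatible s (take n a) (proj₁ split-res))))

someResolution : (α : Vec Three m) → Σ[ a ∈ Vec Bool m ] Resolution α a
someResolution []      = [] , λ ()
someResolution (x ∷ α) =
  let b , rb = resolve x ; a , ra = someResolution α
  in b ∷ a , λ { zero → rb ; (suc i) → ra i }
  where
  resolve : ∀ x → Σ[ b ∈ Bool ] (x ≢ 𝐮 → ι b ≡ x)
  resolve 𝟎 = false , λ _ → refl
  resolve 𝐮 = false , λ x≢𝐮 → contradiction refl x≢𝐮
  resolve 𝟏 = true  , λ _ → refl

stable-unique : (f : Vec Bool m → Bool) (α : Vec Three m) {b c : Bool} →
                Stable f α b → Stable f α c → b ≡ c
stable-unique f α sb sc = let a , res = someResolution α in trans (sym (sb a res)) (sc a res)

-- Having a resolution, `α` cannot be stable for both bits, so whichever test succeeds is the one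
-- for `c`.
stable⇒extension : (f : Vec Bool m → Bool) (α : Vec Three m) (c : Bool) →
                   Stable f α c → hazardFreeExtension f α ≡ ι c
stable⇒extension f α c st with stable? f α false | stable? f α true
... | yes st₀ | _       = cong ι (stable-unique f α st₀ st)
... | no _    | yes st₁ = cong ι (stable-unique f α st₁ st)
stable⇒extension f α false st | no ¬st₀ | no _    = contradiction st ¬st₀
stable⇒extension f α true  st | no _    | no ¬st₁ = contradiction st ¬st₁

-- Rectangles of a formula

-- A weighted count: `c` will be the 0/1 indicator of one kind of leaf, which also bounds the rank
-- on that leaf's rectangle.
leaves : (Literal m → ℕ) → Formula m → ℕ
leaves c (leaf l) = c l
leaves c (F ∧ G)  = leaves c F + leaves c G
leaves c (F ∨ G)  = leaves c F + leaves c G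

-- Zero outside the rectangle of `X` and `Y`, so that matrices on disjoint rectangles can be added.
restrict : (R → Bool) → (Vec Three n → Bool) → Matrix R n → Matrix R n
restrict X Y M s t = X s ∧ᵇ Y t ∧ᵇ M s t

is𝟎 is𝟏 : Three → Bool
is𝟎 𝟎 = true
is𝟎 _ = false
is𝟏 𝟏 = true
is𝟏 _ = false

is𝟎-sound : ∀ x → is𝟎 x ≡ true → x ≡ 𝟎
is𝟎-sound 𝟎 _ = refl

is𝟏-sound : ∀ x → is𝟏 x ≡ true → x ≡ 𝟏
is𝟏-sound 𝟏 _ = refl

∧₃-𝟏 : ∀ x y → x ∧₃ y ≡ 𝟏 → x ≡ 𝟏 × y ≡ 𝟏
∧₃-𝟏 𝟏 𝟏 _ = refl , refl
∧₃-𝟏 𝐮 𝟎 ()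
∧₃-𝟏 𝐮 𝐮 ()
∧₃-𝟏 𝐮 𝟏 ()

∨₃-𝟎 : ∀ x y → x ∨₃ y ≡ 𝟎 → x ≡ 𝟎 × y ≡ 𝟎
∨₃-𝟎 𝟎 𝟎 _ = refl , refl
∨₃-𝟎 𝐮 𝟎 ()
∨₃-𝟎 𝐮 𝐮 ()
∨₃-𝟎 𝐮 𝟏 ()

∧₃-𝟎ʳ : ∀ x y → x ∧₃ y ≡ 𝟎 → not (is𝟎 x) ≡ true → y ≡ 𝟎
∧₃-𝟎ʳ 𝐮 𝟎 _ _ = refl
∧₃-𝟎ʳ 𝟏 𝟎 _ _ = refl

∨₃-𝟏ʳ : ∀ x y → x ∨₃ y ≡ 𝟏 → not (is𝟏 x) ≡ true → y ≡ 𝟏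
∨₃-𝟏ʳ 𝟎 𝟏 _ _ = refl
∨₃-𝟏ʳ 𝐮 𝟏 _ _ = refl

module Rectangles {R : Set} (α : R → Vec Three m) (β : Vec Three n → Vec Three m) where

  -- The invariant of a Karchmer-Wigderson rectangle, with definite values required on both sides.
  Separates : Formula m → (R → Bool) → (Vec Three n → Bool) → Set
  Separates G X Y =
    (∀ s → X s ≡ true → eval G (α s) ≡ 𝟏) × (∀ t → Y t ≡ true → eval G (β t) ≡ 𝟎)

  -- A conjunction is 𝟎 only if some conjunct is 𝟎, even in the presence of 𝐮. So at ∧ the columns
  -- split by whether `F` is 𝟎, while both conjuncts are 𝟏 on all rows; ∨ is dual and splits the
  -- rows. The matrix is the sum of its two parts, and rank is subadditive.
  rank≤leaves : (c : Literal m → ℕ) (M : Matrix R n) →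
    (∀ l X Y → Separates (leaf l) X Y → RankAtMost (c l) (restrict X Y M)) →
    ∀ G X Y → Separates G X Y → RankAtMost (leaves c G) (restrict X Y M)
  rank≤leaves c M base (leaf l) X Y sep = base l X Y sep
  rank≤leaves c M base (F ∧ G) X Y (one , zer) = rank-resp
    -- `z` marks the columns where `F` is 𝟎; `con true :+ z` is its complement, and the two sum to
    -- 1.
    (λ s t → solve 4 (λ z x y m →
        x :* (y :* m) := x :* ((y :* z) :* m) :+ x :* ((y :* (con true :+ z)) :* m))
      refl (is𝟎 (eval F (β t))) (X s) (Y t) (M s t))
    (rank-+
      (rank≤leaves c M base F X (λ t → Y t ∧ᵇ is𝟎 (eval F (β t)))
        ( (λ s Xs → proj₁ (∧₃-𝟏 _ _ (one s Xs)))
        , (λ t p → is𝟎-sound _ (∧-conicalʳ (Y t) _ p))))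
      (rank≤leaves c M base G X (λ t → Y t ∧ᵇ not (is𝟎 (eval F (β t))))
        ( (λ s Xs → proj₂ (∧₃-𝟏 _ _ (one s Xs)))
        , (λ t p → ∧₃-𝟎ʳ _ _ (zer t (∧-conicalˡ _ _ p)) (∧-conicalʳ (Y t) _ p)))))
    where open xor-∧-Solver
  rank≤leaves c M base (F ∨ G) X Y (one , zer) = rank-resp
    (λ s t → solve 4 (λ z x y m →
        x :* (y :* m) := (x :* z) :* (y :* m) :+ (x :* (con true :+ z)) :* (y :* m))
      refl (is𝟏 (eval F (α s))) (X s) (Y t) (M s t))
    (rank-+
      (rank≤leaves c M base F (λ s → X s ∧ᵇ is𝟏 (eval F (α s))) Y
        ( (λ s p → is𝟏-sound _ (∧-conicalʳ (X s) _ p))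
        , (λ t Yt → proj₁ (∨₃-𝟎 _ _ (zer t Yt)))))
      (rank≤leaves c M base G (λ s → X s ∧ᵇ not (is𝟏 (eval F (α s)))) Y
        ( (λ s p → ∨₃-𝟏ʳ _ _ (one s (∧-conicalˡ _ _ p)) (∧-conicalʳ (X s) _ p))
        , (λ t Yt → proj₂ (∨₃-𝟎 _ _ (zer t Yt))))))
    where open xor-∧-Solver

restrict-true : (X : R → Bool) (Y : Vec Three n → Bool) (M : Matrix R n) →
  (∀ s t → X s ≡ true → Y t ≡ true → M s t ≡ true) → ∀ s t → restrict X Y M s t ≡ X s ∧ᵇ Y t
restrict-true X Y M h s t with X s | Y t | h s t
... | false | _     | _ = refl
... | true  | false | _ = refl
... | true  | true  | e = e refl refl

restrict-false : (X : R → Bool) (Y : Vec Three n → Bool) (M : Matrix R n) →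
  (∀ s t → X s ≡ true → Y t ≡ true → M s t ≡ false) → ∀ s t → restrict X Y M s t ≡ false
restrict-false X Y M h s t with X s | Y t | h s t
... | false | _     | _ = refl
... | true  | false | _ = refl
... | true  | true  | e = e refl refl

-- Data and selector leaves of the multiplexer

variable-of : Literal m → Fin m
variable-of (pos i) = i
variable-of (neg i) = i

dataLiteral selectorLiteral : ∀ n → Literal (n + 2 ^ n) → ℕ
dataLiteral     n l = [ const 0 , const 1 ]′ (splitAt n (variable-of l))
selectorLiteral n l = [ const 1 , const 0 ]′ (splitAt n (variable-of l))

data-or-selector : ∀ n l → dataLiteral n l + selectorLiteral n l ≡ 1
data-or-selector n l with splitAt n (variable-of l)
... | inj₁ _ = refl
... | inj₂ _ = refl

cell-𝟏 : ∀ (s : Vec Three n) b → cell true s b ≡ 𝟏 → compatible s (map ι (unbin _ b)) ≡ true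
cell-𝟏 s b eq with compatible s (map ι (unbin _ b))
... | true = refl

cell-𝟎 : ∀ (s : Vec Three n) b → cell false s b ≡ 𝟎 → compatible s (map ι (unbin _ b)) ≡ true
cell-𝟎 s b eq with compatible s (map ι (unbin _ b))
... | true = refl

-- The cell is 𝟏 or 𝐮, hence its negation 𝟎 or 𝐮.
cell-¬𝟏 : ∀ (s : Vec Three n) b → ¬₃ cell true s b ≢ 𝟏
cell-¬𝟏 s b eq with compatible s (map ι (unbin _ b))
cell-¬𝟏 s b () | true
cell-¬𝟏 s b () | false

module Mux (n : ℕ) where
  open Rectangles (block {n} true) (block {n} false)

  lookup-block : ∀ c (s : Vec Three n) i → lookup (block c s) i ≡ [ lookup s , cell c s ]′ (splitAt n i)
  lookup-block c s i with splitAt n i | lookup-splitAt n s (tabulate (cell c s)) i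
  ... | inj₁ j | eq = eq
  ... | inj₂ b | eq = trans eq (lookup∘tabulate (cell c s) b)

  agree-𝟏𝟎 : ∀ {x y} → x ≡ 𝟏 → y ≡ 𝟎 → agree x y ≡ false
  agree-𝟏𝟎 refl refl = refl

  agree-¬𝟏𝟎 : ∀ x y → ¬₃ x ≡ 𝟏 → ¬₃ y ≡ 𝟎 → agree x y ≡ false
  agree-¬𝟏𝟎 𝟎 𝟏 _ _ = refl

  -- A negated data literal is never 𝟏 on `block true s`, so its rectangle is empty.
  leaf-type : ∀ l (s t : Vec Three n) → evalLiteral l (block true s) ≡ 𝟏 → evalLiteral l (block false t) ≡ 𝟎 →
    [ const (compatible s t ≡ false) , const (compatible s t ≡ true) ]′ (splitAt n (variable-of l))
  leaf-type (pos i) s t p q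
    rewrite lookup-block true s i | lookup-block false t i with splitAt n i
  ... | inj₁ j = conflict⇒incompatible s t j (agree-𝟏𝟎 p q)
  -- Both blocks are definite at data bit `b`, so its address resolves both `s` and `t`.
  ... | inj₂ b = compatible-via s t (unbin n b) (cell-𝟏 s b p) (cell-𝟎 t b q)
  leaf-type (neg i) s t p q
    rewrite lookup-block true s i | lookup-block false t i with splitAt n i
  ... | inj₁ j = conflict⇒incompatible s t j (agree-¬𝟏𝟎 (lookup s j) (lookup t j) p q)
  ... | inj₂ b = contradiction p (cell-¬𝟏 s b)

  -- The restriction vanishes on a selector leaf; on a data leaf it is the full rectangle, of rank
  -- at most one.
  data-rank : ∀ l X Y → Separates (leaf l) X Y →
              RankAtMost (dataLiteral n l) (restrict X Y compatible)
  data-rank l X Y (one , zer) with splitAt n (variable-of l)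
      | (λ s t Xs Yt → leaf-type l s t (one s Xs) (zer t Yt))
  ... | inj₁ _ | h = rank-resp (restrict-false X Y _ h) rank-zero
  ... | inj₂ _ | h = rank-resp (restrict-true X Y _ h) (rank-one X Y)

  -- Complementing the matrix exchanges the roles of the two kinds of leaf.
  selector-rank : ∀ l X Y → Separates (leaf l) X Y →
                  RankAtMost (selectorLiteral n l) (restrict X Y (λ s t → not (compatible s t)))
  selector-rank l X Y (one , zer) with splitAt n (variable-of l)
      | (λ s t Xs Yt → leaf-type l s t (one s Xs) (zer t Yt))
  ... | inj₁ _ | h = rank-resp (restrict-true X Y _ (λ s t p q → cong not (h s t p q))) (rank-one X Y)
  ... | inj₂ _ | h = rank-resp (restrict-false X Y _ (λ s t p q → cong not (h s t p q))) rank-zero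

  module _ (F : Formula (n + 2 ^ n)) (hf : HazardFree F (MUX n)) where

    eval-block : ∀ c (s : Vec Three n) → eval F (block c s) ≡ ι c
    eval-block c s = trans (hf (block c s)) (stable⇒extension (MUX n) (block c s) c (block-stable c s))

    separates : Separates F (const true) (const true)
    separates = (λ s _ → eval-block true s) , (λ t _ → eval-block false t)

    data-leaves : 3 ^ n ≤ leaves (dataLiteral n) F
    data-leaves = rank-lower-bound {M = compatible} compatible-injective
      (rank≤leaves (dataLiteral n) compatible data-rank F _ _ separates)

    -- The leaves bound the rank of J - C, while the invertible matrix is C = J + (J - C); the
    -- all-ones J costs one more unit of rank.
    selector-leaves : 3 ^ n ≤ 1 + leaves (selectorLiteral n) F
    selector-leaves = rank-lower-bound {M = compatible} compatible-injective
      (rank-resp (λ s t → solve 1 (λ m → m := con true :+ (con true :+ m)) refl (compatible s t))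
        (rank-+ (rank-one (const true) (const true))
          (rank≤leaves (selectorLiteral n) _ selector-rank F _ _ separates)))
      where open xor-∧-Solver

-- Leaf count and depth

-- Each leaf has total weight 1, so the left side is the number of leaves of a binary tree.
leaves-≤ : (c d : Literal m → ℕ) → (∀ l → c l + d l ≡ 1) →
           ∀ G → leaves c G + leaves d G ≤ 2 ^ depth G
leaves-≤ c d one = go
  where
  open ℕ.≤-Reasoning

  -- This also covers ∨, whose `leaves` and `depth` obey the same equations.
  node : ∀ F G → leaves c F + leaves d F ≤ 2 ^ depth F → leaves c G + leaves d G ≤ 2 ^ depth G →
         (leaves c F + leaves c G) + (leaves d F + leaves d G) ≤ 2 ^ depth (F ∧ G)
  node F G f g = begin
    (leaves c F + leaves c G) + (leaves d F + leaves d G)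
      ≡⟨ interchange (leaves c F) _ _ _ ⟩
    (leaves c F + leaves d F) + (leaves c G + leaves d G)
      ≤⟨ ℕ.+-mono-≤ (ℕ.≤-trans f (ℕ.^-monoʳ-≤ 2 (ℕ.m≤m⊔n (depth F) (depth G))))
                    (ℕ.≤-trans g (ℕ.^-monoʳ-≤ 2 (ℕ.m≤n⊔m (depth F) (depth G)))) ⟩
    2 ^ (depth F ⊔ depth G) + 2 ^ (depth F ⊔ depth G)
      ≡⟨ cong (2 ^ (depth F ⊔ depth G) +_) (ℕ.+-identityʳ _) ⟨
    2 ^ depth (F ∧ G) ∎

  go : ∀ G → leaves c G + leaves d G ≤ 2 ^ depth G
  go (leaf l) = ℕ.≤-reflexive (one l)
  go (F ∧ G)  = node F G (go F) (go G)
  go (F ∨ G)  = node F G (go F) (go G)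

corollary5p14 : (n : ℕ) → 1 ≤ n → (F : Formula (n + 2 ^ n)) →
    Computes F (MUX n) → HazardFree F (MUX n) →
    ⌈log₂ (2 * 3 ^ n ∸ 1) ⌉ ≤ depth F
corollary5p14 n _ F _ hf = begin
  ⌈log₂ (2 * 3 ^ n ∸ 1) ⌉  ≤⟨ ⌈log₂⌉-mono-≤ size ⟩
  ⌈log₂ (2 ^ depth F) ⌉    ≡⟨ ⌈log₂2^n⌉≡n (depth F) ⟩
  depth F                  ∎
  where
  open ℕ.≤-Reasoning
  D S : ℕ
  D = leaves (dataLiteral n) F
  S = leaves (selectorLiteral n) F

  size : 2 * 3 ^ n ∸ 1 ≤ 2 ^ depth F
  size = begin
    2 * 3 ^ n ∸ 1        ≡⟨ cong (λ k → 3 ^ n + k ∸ 1) (ℕ.+-identityʳ (3 ^ n)) ⟩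
    3 ^ n + 3 ^ n ∸ 1    ≤⟨ ℕ.∸-monoˡ-≤ 1 (ℕ.+-mono-≤ (Mux.data-leaves n F hf) (Mux.selector-leaves n F hf)) ⟩
    -- The 1 spent on the all-ones matrix is the 1 subtracted in the bound.
    D + (1 + S) ∸ 1      ≡⟨ cong (_∸ 1) (ℕ.+-suc D S) ⟩
    D + S                ≤⟨ leaves-≤ _ _ (data-or-selector n) F ⟩
    2 ^ depth F          ∎
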